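{- Let $d \equiv 2 \pmod 4$ be a square-free positive integer such that both equations $x^2 - dy^2 = -1$ and $x^2 - dy^2 = 6$ have solutions in integers $x, y$. Let $n = 4m + 4k\sqrt{d}$ with $m, k \in \mathbb{Z}$, and suppose it is not the case that both $m \equiv 5 \pmod 6$ and $k \equiv 3 \pmod 6$. Then there exist infinitely many $D(n)$-quadruples in $\mathbb{Z}[\sqrt{d}]$.
   Context: For $n \in \mathbb{Z}[\sqrt{d}]$, a set $\{a_1,a_2,a_3,a_4\}$ of four distinct non-zero elements of $\mathbb{Z}[\sqrt{d}]$ is called a $D(n)$-quadruple in $\mathbb{Z}[\sqrt{d}]$ if $a_ia_j + n$ is a square of an element of $\mathbb{Z}[\sqrt{d}]$ for all $1 \le i < j \le 4$. -}

module Defs where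

open import Data.Integer.Base as ℤ using (ℤ; +_; 0ℤ)
open import Data.Nat.Base as ℕ using (ℕ)
open import Data.Nat.Divisibility using (_∣_)
open import Data.Product.Base using (∃; ∃₂)
open import Data.Vec.Base using (Vec)
open import Data.Vec.Membership.Propositional using (_∈_)
open import Data.Vec.Relation.Unary.All using (All)
open import Data.Vec.Relation.Unary.AllPairs using (AllPairs)
open import Data.Vec.Relation.Unary.Unique.Propositional using (Unique)
open import Function.Bundles using (Injection)
open import Level using (Level; 0ℓ; _⊔_)
open import Relation.Binary.Bundles using (Setoid)
open import Relation.Binary.PropositionalEquality using (_≡_; _≢_; setoid)
import Relation.Binary.Construct.On as On
open import Relation.Unary.Relation.Binary.Equality using (≐-setoid)

SquareFree : ℕ → Set
SquareFree d = ∀ k → k ℕ.* k ∣ d → k ≡ 1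

PellSolvable : ℕ → ℤ → Set
PellSolvable d c = ∃₂ λ (x y : ℤ) → x ℤ.^ 2 ℤ.- + d ℤ.* y ℤ.^ 2 ≡ c

-- The pair  a +√ b  stands for  a + b√d.  When d is not a perfect square the
-- two coordinates are determined by the element, so _≡_ is the equality of ℤ[√d].
infix 5 _+√_

record ℤ[√_] (d : ℕ) : Set where
  constructor _+√_
  field
    rational   : ℤ
    irrational : ℤ

module _ {d : ℕ} where

  infixl 6 _+_
  infixl 7 _*_

  0# : ℤ[√ d ]
  0# = 0ℤ +√ 0ℤ

  _+_ : ℤ[√ d ] → ℤ[√ d ] → ℤ[√ d ]
  (a +√ b) + (a′ +√ b′) = (a ℤ.+ a′) +√ (b ℤ.+ b′)

  _*_ : ℤ[√ d ] → ℤ[√ d ] → ℤ[√ d ]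
  (a +√ b) * (a′ +√ b′) =
    (a ℤ.* a′ ℤ.+ + d ℤ.* (b ℤ.* b′)) +√ (a ℤ.* b′ ℤ.+ b ℤ.* a′)

  IsSquare : ℤ[√ d ] → Set
  IsSquare x = ∃ λ y → x ≡ y * y

  record DQuadruple (n : ℤ[√ d ]) : Set where
    field
      elements : Vec ℤ[√ d ] 4
      distinct : Unique elements
      nonZero  : All (_≢ 0#) elements
      squares  : AllPairs (λ a b → IsSquare (a * b + n)) elements

  -- A quadruple is a set: two of them are equal when they have the same members,
  -- whatever the order in which these are listed.
  DQuadrupleSetoid : ℤ[√ d ] → Setoid 0ℓ 0ℓ
  DQuadrupleSetoid n =
    On.setoid (≐-setoid ℤ[√ d ] 0ℓ)
              (λ (q : DQuadruple n) x → x ∈ DQuadruple.elements q)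

private variable
  c ℓ : Level

-- A sequence of elements no two of which are identified by the setoid equality.
Infinite : Setoid c ℓ → Set (c ⊔ ℓ)
Infinite S = Injection (setoid ℕ) S

{-# OPTIONS --safe #-}
-- Write n = 4pq and let w = 1 + 4z be a unit of norm 1 with conjugate w̄.  With
-- α = q - 9p and β = q - p, the set
--   { α w̄ , (α w̄ + β w)/4 - (q + 3p)/2 , (α w̄ + β w)/4 + (q + 3p)/2 , β w }
-- is a D(n)-quadruple unless it degenerates.  It is found as the regular quadruple
-- { a , b , a + b + 2r , a + 4b + 4r } with a b + n = r², where the remaining condition
-- that a(a + 4b + 4r) + n = (a + 2r)² - 3n be a square is met by factoring 3n as 6p · 2q.
-- A solution of x² - dy² = -1 gives the unit (x + y√d)⁴ = 1 + 4z, and repeated squaring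
-- makes z divisible by any power of 2.  Modulo a large power of 2 the four elements are
-- α, -4p, β, β, which excludes degeneracy for infinitely many w as soon as q is not
-- a nonzero integer multiple of p ≠ 0.  One takes p = 1 if n is irrational and p = x + y√d otherwise.
module Submission where

open import Defs using (SquareFree; PellSolvable; ℤ[√_]; _+√_; DQuadrupleSetoid; Infinite)
open import Data.Integer.Base using (ℤ; +_; -1ℤ; _*_; _%ℕ_)
open import Data.Nat.Base using (ℕ; _%_; _>_)
open import Data.Product.Base using (_×_)
open import Relation.Binary.PropositionalEquality using (_≡_)
open import Relation.Nullary.Negation using (¬_)

import Algebra.Solver.Ring as RingSolver
open import Algebra.Solver.Ring.AlmostCommutativeRing using (AlmostCommutativeRing; _-Raw-AlmostCommutative⟶_)
open import Algebra.Structures.Biased using (isCommutativeSemiringˡ; isCommutativeMonoidˡ)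
open import Data.Integer.Base as ℤ using (0ℤ; 1ℤ; ∣_∣; -[1+_])
import Data.Integer.Properties as ℤ
open import Data.Integer.Tactic.RingSolver using (solve-∀)
open import Data.List.Base as List using (List; []; _∷_)
open import Data.List.Extrema.Nat using (max; xs≤max)
open import Data.List.Relation.Unary.All as All using (All; []; _∷_)
open import Data.List.Relation.Unary.All.Properties using (map⁻)
import Data.Maybe.Base as Maybe
open import Data.Nat.Base as ℕ using (zero; suc; _<_; _^_; s≤s; z≤n)
open import Data.Nat.Divisibility using (_∣_; divides; ∣⇒≤)
import Data.Nat.Properties as ℕ
open import Data.Product.Base using (∃; _,_; proj₁; proj₂)
open import Data.Sum.Base using (_⊎_; inj₁; inj₂; [_,_]′)
open import Data.Vec.Base using ([]; _∷_)
open import Data.Vec.Membership.Propositional using (_∈_)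
open import Data.Vec.Relation.Unary.All using ([]; _∷_)
open import Data.Vec.Relation.Unary.AllPairs using ([]; _∷_)
open import Data.Vec.Relation.Unary.Any using (here; there)
open import Defs using (0#; DQuadruple) renaming (_+_ to _⊕_; _*_ to _⊗_)
open import Function.Base using (_∘_; id)
open import Level using (0ℓ)
open import Relation.Binary.Definitions using (tri<; tri≈; tri>)
open import Relation.Binary.PropositionalEquality using (_≢_; refl; sym; trans; cong; cong₂; subst; isEquivalence; module ≡-Reasoning)
open import Relation.Nullary.Decidable using (Dec; dec⇒maybe; yes; no)
open import Relation.Nullary.Negation using (contradiction)

-- Polynomial identities over a commutative ring with coefficients from ℤ

module Identities {c ℓ} (R : AlmostCommutativeRing c ℓ)
  (φ : ℤ.+-*-rawRing -Raw-AlmostCommutative⟶ R)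
  where

  open AlmostCommutativeRing R
    hiding (0#; 1#; zero; sym) renaming (refl to ≈-refl; trans to ≈-trans; _*_ to _·_)
  open _-Raw-AlmostCommutative⟶_ φ using () renaming (⟦_⟧ to ι)
  open RingSolver ℤ.+-*-rawRing R φ (λ x y → Maybe.map (reflexive ∘ cong ι) (dec⇒maybe (x ℤ.≟ y)))

  infixl 6 _-_
  _-_ : Carrier → Carrier → Carrier
  x - y = x + - y

  -- For w = 1 + 4z and w̄ = 1 + 4z̄ one has w w̄ = 1 + 4 · defect z z̄.
  defect : Carrier → Carrier → Carrier
  defect z z̄ = z + z̄ + ι (+ 4) · (z · z̄)

  -- 1 + 4 · double z = (1 + 4z)²
  double : Carrier → Carrier
  double z = ι (+ 2) · z + ι (+ 4) · (z · z)

  unit : Carrier → Carrier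
  unit z = ι (+ 1) + ι (+ 4) · z

  private
    1′ 2′ 3′ 4′ : ∀ {n} → Polynomial n
    1′ = con (+ 1)
    2′ = con (+ 2)
    3′ = con (+ 3)
    4′ = con (+ 4)

    defect′ : ∀ {n} → Polynomial n → Polynomial n → Polynomial n
    defect′ z z̄ = z :+ z̄ :+ 4′ :* (z :* z̄)

    double′ unit′ : ∀ {n} → Polynomial n → Polynomial n
    double′ z = 2′ :* z :+ 4′ :* (z :* z)
    unit′ z = 1′ :+ 4′ :* z

  x-y≈0 : ∀ {x y} → x ≈ y → x - y ≈ ι (+ 0)
  x-y≈0 {x} {y} x≈y = ≈-trans (+-congʳ x≈y)
    (solve 1 (λ y → y :- y := con (+ 0)) ≈-refl y)

  -- How relations such as `defect z z̄ ≈ ι (+ 0)` enter: the solver proves an unconditional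
  -- identity in which the vanishing expression `s` carries an explicit cofactor `c`, and that term
  -- is then dropped.
  absorb : ∀ {x y c s} → x ≈ y + c · s → s ≈ ι (+ 0) → x ≈ y
  absorb {x} {y} {c} x≈y+cs s≈0 = ≈-trans x≈y+cs (≈-trans (+-congˡ (*-congˡ s≈0))
    (solve 2 (λ y c → y :+ c :* con (+ 0) := y) ≈-refl y c))

  x-y≈0⇒x≈y : ∀ x y → x - y ≈ ι (+ 0) → x ≈ y
  x-y≈0⇒x≈y x y = absorb (solve 2 (λ x y → x := y :+ 1′ :* (x :- y)) ≈-refl x y)

  unit-norm : ∀ z z̄ → defect z z̄ ≈ ι (+ 0) → unit z · unit z̄ ≈ ι (+ 1)
  unit-norm z z̄ = absorb (solve 2 (λ z z̄ → unit′ z :* unit′ z̄ := 1′ :+ 4′ :* defect′ z z̄) ≈-refl z z̄)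

  -- Squaring w squares its norm 1 + 4e, so the defect e becomes 2e + 4e², a multiple of e.
  defect-double : ∀ z z̄ → defect z z̄ ≈ ι (+ 0) → defect (double z) (double z̄) ≈ ι (+ 0)
  defect-double z z̄ = absorb (solve 2 (λ z z̄ →
    defect′ (double′ z) (double′ z̄) :=
      con (+ 0) :+ (2′ :+ 4′ :* defect′ z z̄) :* defect′ z z̄) ≈-refl z z̄)

  -- The extra factor 2 beside `m` is what makes powers of 2 accumulate under repeated squaring.
  double-multiple : ∀ m y → double (m · y) ≈ m · (ι (+ 2) · (y + ι (+ 2) · (y · (m · y))))
  double-multiple = solve 2 (λ m y →
    double′ (m :* y) := m :* (2′ :* (y :+ 2′ :* (y :* (m :* y))))) ≈-refl

  difference-multiple : ∀ x y m k l → x + m · k ≈ y + m · l → x - y ≈ m · (l - k)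
  difference-multiple x y m k l eq = ≈-trans
    (solve 5 (λ x y m k l → x :- y := (x :+ m :* k) :- (y :+ m :* l) :+ m :* (l :- k)) ≈-refl x y m k l)
    (≈-trans (+-congʳ (x-y≈0 eq)) (solve 1 (λ x → con (+ 0) :+ x := x) ≈-refl _))

  -- Multiply x(w - 1) = 0 by w̄ - 1; when w w̄ = 1, the product (w - 1)(w̄ - 1) is 2 - w - w̄.
  fixed⇒annihilated : ∀ x w w̄ → x · w ≈ x → w · w̄ ≈ ι (+ 1) → (ι (+ 2) - (w + w̄)) · x ≈ ι (+ 0)
  fixed⇒annihilated x w w̄ xw≈x ww̄≈1 = absorb (absorb (solve 3 (λ x w w̄ →
    (2′ :- (w :+ w̄)) :* x :=
      con (+ 0) :+ (w̄ :- 1′) :* (x :* w :- x) :+ (:- x) :* (w :* w̄ :- 1′)) ≈-refl x w w̄)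
    (x-y≈0 ww̄≈1)) (x-y≈0 xw≈x)

  module _ (w w̄ v v̄ : Carrier) (ww̄≈1 : w · w̄ ≈ ι (+ 1)) where

    -- For units of norm 1, w v̄ is w/v. Equal first elements α w̄ = α v̄ of two quadruples thus
    -- give a unit fixing α.
    fixed-by-quotient : ∀ x → x · w̄ ≈ x · v̄ → x · (w · v̄) ≈ x
    fixed-by-quotient x xw̄≈xv̄ = absorb (absorb (solve 4 (λ x w w̄ v̄ →
      x :* (w :* v̄) := x :+ (:- w) :* (x :* w̄ :- x :* v̄) :+ x :* (w :* w̄ :- 1′)) ≈-refl x w w̄ v̄)
      (x-y≈0 ww̄≈1)) (x-y≈0 xw̄≈xv̄)

    quotient-norm : v · v̄ ≈ ι (+ 1) → (w · v̄) · (w̄ · v) ≈ ι (+ 1)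
    quotient-norm vv̄≈1 = absorb (absorb (solve 4 (λ w w̄ v v̄ →
      (w :* v̄) :* (w̄ :* v) := 1′ :+ (v :* v̄) :* (w :* w̄ :- 1′) :+ 1′ :* (v :* v̄ :- 1′)) ≈-refl w w̄ v v̄)
      (x-y≈0 vv̄≈1)) (x-y≈0 ww̄≈1)

    trivial-quotient : v · v̄ ≈ ι (+ 1) → w · v̄ ≈ ι (+ 1) → v ≈ w
    trivial-quotient vv̄≈1 wv̄≈1 = absorb (absorb (solve 3 (λ w v v̄ →
      v := w :+ (:- v) :* (w :* v̄ :- 1′) :+ w :* (v :* v̄ :- 1′)) ≈-refl w v v̄)
      (x-y≈0 vv̄≈1)) (x-y≈0 wv̄≈1)

  module Quadruple (p q : Carrier) where

    -- At z = z̄ = 0, where w = 1, the four elements are `α`, `γ`, `β`, `β`, and `δ` is the value of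
    -- 3a₄ + α, the quantity that separates a₃ from a₄.
    n α β γ δ : Carrier
    n = ι (+ 4) · (p · q)
    α = q - ι (+ 9) · p
    β = q - p
    γ = - (ι (+ 4) · p)
    δ = ι (+ 3) · β + α

    private
      n′ α′ β′ γ′ δ′ : ∀ {k} → Polynomial k → Polynomial k → Polynomial k
      n′ p q = 4′ :* (p :* q)
      α′ p q = q :- con (+ 9) :* p
      β′ p q = q :- p
      γ′ p q = :- (4′ :* p)
      δ′ p q = 3′ :* β′ p q :+ α′ p q

    -- Each difference in this group is a nonzero integer times p or times some q - cp with c ≠ 0;
    -- these are the elements assumed or shown not to vanish in `Family`.
    α-0 : α - ι (+ 0) ≈ ι (+ 1) · (q - ι (+ 9) · p)
    α-0 = solve 2 (λ p q → α′ p q :- con (+ 0) := 1′ :* (q :- con (+ 9) :* p)) ≈-refl p q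

    β-0 : β - ι (+ 0) ≈ ι (+ 1) · (q - ι (+ 1) · p)
    β-0 = solve 2 (λ p q → β′ p q :- con (+ 0) := 1′ :* (q :- 1′ :* p)) ≈-refl p q

    γ-0 : γ - ι (+ 0) ≈ ι (-[1+ 3 ]) · p
    γ-0 = solve 2 (λ p q → γ′ p q :- con (+ 0) := con (-[1+ 3 ]) :* p) ≈-refl p q

    δ-0 : δ - ι (+ 0) ≈ ι (+ 4) · (q - ι (+ 3) · p)
    δ-0 = solve 2 (λ p q → δ′ p q :- con (+ 0) := 4′ :* (q :- 3′ :* p)) ≈-refl p q

    α-β : α - β ≈ ι (-[1+ 7 ]) · p
    α-β = solve 2 (λ p q → α′ p q :- β′ p q := con (-[1+ 7 ]) :* p) ≈-refl p q

    α-γ : α - γ ≈ ι (+ 1) · (q - ι (+ 5) · p)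
    α-γ = solve 2 (λ p q → α′ p q :- γ′ p q := 1′ :* (q :- con (+ 5) :* p)) ≈-refl p q

    β-γ : β - γ ≈ ι (+ 1) · (q - ι (-[1+ 2 ]) · p)
    β-γ = solve 2 (λ p q → β′ p q :- γ′ p q := 1′ :* (q :- con (-[1+ 2 ]) :* p)) ≈-refl p q

    module _ (z z̄ : Carrier) where

      -- Substituting w = 1 + 4z clears the denominators of the quadruple. Identically in z and z̄,
      -- a₃ = a₁ + a₂ + 2r and a₄ = a₁ + 4a₂ + 4r.
      a₁ a₂ a₃ a₄ r : Carrier
      a₁ = α · unit z̄
      a₂ = γ + (α · z̄ + β · z)
      a₃ = β + (α · z̄ + β · z)
      a₄ = β · unit z
      r  = ι (+ 6) · p - ι (+ 2) · (α · z̄)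

      private
        a₁′ a₂′ a₃′ a₄′ r′ : ∀ {k} → Polynomial k → Polynomial k → Polynomial k → Polynomial k → Polynomial k
        a₁′ p q z z̄ = α′ p q :* unit′ z̄
        a₂′ p q z z̄ = γ′ p q :+ (α′ p q :* z̄ :+ β′ p q :* z)
        a₃′ p q z z̄ = β′ p q :+ (α′ p q :* z̄ :+ β′ p q :* z)
        a₄′ p q z z̄ = β′ p q :* unit′ z
        r′  p q z z̄ = con (+ 6) :* p :- 2′ :* (α′ p q :* z̄)

      module _ (norm : defect z z̄ ≈ ι (+ 0)) where

        -- With a = `a₁` and b = `a₂`, the relation ab + n = r² formally yields the roots a + r, b +
        -- r, r + 2b and a + 2b + 3r used for every other pair except `a₁`, `a₄`.
        a₁a₂+n : a₁ · a₂ + n ≈ r · r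
        a₁a₂+n = absorb (solve 4 (λ p q z z̄ →
          a₁′ p q z z̄ :* a₂′ p q z z̄ :+ n′ p q :=
          r′ p q z z̄ :* r′ p q z z̄ :+ (α′ p q :* β′ p q) :* defect′ z z̄) ≈-refl p q z z̄) norm

        a₁a₃+n : a₁ · a₃ + n ≈ (a₁ + r) · (a₁ + r)
        a₁a₃+n = absorb (solve 4 (λ p q z z̄ →
          let s = a₁′ p q z z̄ :+ r′ p q z z̄ in
          a₁′ p q z z̄ :* a₃′ p q z z̄ :+ n′ p q :=
          s :* s :+ (α′ p q :* β′ p q) :* defect′ z z̄) ≈-refl p q z z̄) norm

        a₂a₃+n : a₂ · a₃ + n ≈ (a₂ + r) · (a₂ + r)
        a₂a₃+n = absorb (solve 4 (λ p q z z̄ →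
          let s = a₂′ p q z z̄ :+ r′ p q z z̄ in
          a₂′ p q z z̄ :* a₃′ p q z z̄ :+ n′ p q :=
          s :* s :+ (α′ p q :* β′ p q) :* defect′ z z̄) ≈-refl p q z z̄) norm

        -- The value a₁ + 2r = q + 3p is free of z, and (q + 3p)² - 12pq = (q - 3p)², where q - 3p =
        -- β - 2p.
        a₁a₄+n : a₁ · a₄ + n ≈ (β - ι (+ 2) · p) · (β - ι (+ 2) · p)
        a₁a₄+n = absorb (solve 4 (λ p q z z̄ →
          let s = β′ p q :- 2′ :* p in
          a₁′ p q z z̄ :* a₄′ p q z z̄ :+ n′ p q :=
          s :* s :+ (4′ :* (α′ p q :* β′ p q)) :* defect′ z z̄) ≈-refl p q z z̄) norm

        a₂a₄+n : a₂ · a₄ + n ≈ (r + ι (+ 2) · a₂) · (r + ι (+ 2) · a₂)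
        a₂a₄+n = absorb (solve 4 (λ p q z z̄ →
          let s = r′ p q z z̄ :+ 2′ :* a₂′ p q z z̄ in
          a₂′ p q z z̄ :* a₄′ p q z z̄ :+ n′ p q :=
          s :* s :+ (α′ p q :* β′ p q) :* defect′ z z̄) ≈-refl p q z z̄) norm

        a₃a₄+n : a₃ · a₄ + n ≈ (a₁ + ι (+ 2) · a₂ + ι (+ 3) · r) · (a₁ + ι (+ 2) · a₂ + ι (+ 3) · r)
        a₃a₄+n = absorb (solve 4 (λ p q z z̄ →
          let s = a₁′ p q z z̄ :+ 2′ :* a₂′ p q z z̄ :+ 3′ :* r′ p q z z̄ in
          a₃′ p q z z̄ :* a₄′ p q z z̄ :+ n′ p q :=
          s :* s :+ (α′ p q :* β′ p q) :* defect′ z z̄) ≈-refl p q z z̄) norm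

        -- a₄ - a₃ = (w - 1)(3βw + α)w̄ / 4
        a₄≈a₃⇒fixed : a₄ ≈ a₃ → (ι (+ 3) · a₄ + α) · unit z ≈ ι (+ 3) · a₄ + α
        a₄≈a₃⇒fixed a₄≈a₃ = absorb (absorb (solve 4 (λ p q z z̄ →
          let x = 3′ :* a₄′ p q z z̄ :+ α′ p q in
          x :* unit′ z := x :+ (4′ :* unit′ z) :* (a₄′ p q z z̄ :- a₃′ p q z z̄)
            :+ (4′ :* α′ p q) :* defect′ z z̄) ≈-refl p q z z̄) norm) (x-y≈0 a₄≈a₃)

    module _ (m y ȳ : Carrier) where

      -- Putting z = my and z̄ = mȳ splits each expression into its value at z = z̄ = 0 and an
      -- explicit multiple of m.
      a₁-residue : a₁ (m · y) (m · ȳ) ≈ α + m · (ι (+ 4) · (α · ȳ))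
      a₁-residue = solve 3 (λ α m ȳ → α :* unit′ (m :* ȳ) := α :+ m :* (4′ :* (α :* ȳ))) ≈-refl α m ȳ

      a₂-residue : a₂ (m · y) (m · ȳ) ≈ γ + m · (α · ȳ + β · y)
      a₂-residue = solve 6 (λ α β γ m y ȳ → γ :+ (α :* (m :* ȳ) :+ β :* (m :* y)) :=
        γ :+ m :* (α :* ȳ :+ β :* y)) ≈-refl α β γ m y ȳ

      a₃-residue : a₃ (m · y) (m · ȳ) ≈ β + m · (α · ȳ + β · y)
      a₃-residue = solve 5 (λ α β m y ȳ → β :+ (α :* (m :* ȳ) :+ β :* (m :* y)) :=
        β :+ m :* (α :* ȳ :+ β :* y)) ≈-refl α β m y ȳ

      a₄-residue : a₄ (m · y) (m · ȳ) ≈ β + m · (ι (+ 4) · (β · y))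
      a₄-residue = solve 3 (λ β m y → β :* unit′ (m :* y) := β :+ m :* (4′ :* (β :* y))) ≈-refl β m y

      3a₄+α-residue : ι (+ 3) · a₄ (m · y) (m · ȳ) + α ≈ δ + m · (ι (+ 12) · (β · y))
      3a₄+α-residue = solve 4 (λ α β m y → 3′ :* (β :* unit′ (m :* y)) :+ α :=
        3′ :* β :+ α :+ m :* (con (+ 12) :* (β :* y))) ≈-refl α β m y

-- The ring ℤ[√d] and its conjugation

module _ {d : ℕ} where

  infix  8 ⊝_

  ι : ℤ → ℤ[√ d ]
  ι c = c +√ 0ℤ

  1# : ℤ[√ d ]
  1# = ι 1ℤ

  ⊝_ : ℤ[√ d ] → ℤ[√ d ]
  ⊝ (a +√ b) = (ℤ.- a) +√ (ℤ.- b)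

  conj : ℤ[√ d ] → ℤ[√ d ]
  conj (a +√ b) = a +√ (ℤ.- b)

  ⊗-assoc : ∀ (x y z : ℤ[√ d ]) → (x ⊗ y) ⊗ z ≡ x ⊗ (y ⊗ z)
  ⊗-assoc (a +√ b) (a′ +√ b′) (a″ +√ b″) =
    cong₂ _+√_ (rat (+ d) a b a′ b′ a″ b″) (irr (+ d) a b a′ b′ a″ b″)
    where
    rat : ∀ d a b a′ b′ a″ b″ →
          (a * a′ ℤ.+ d * (b * b′)) * a″ ℤ.+ d * ((a * b′ ℤ.+ b * a′) * b″)
        ≡ a * (a′ * a″ ℤ.+ d * (b′ * b″)) ℤ.+ d * (b * (a′ * b″ ℤ.+ b′ * a″))
    rat = solve-∀
    irr : ∀ d a b a′ b′ a″ b″ →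
          (a * a′ ℤ.+ d * (b * b′)) * b″ ℤ.+ (a * b′ ℤ.+ b * a′) * a″
        ≡ a * (a′ * b″ ℤ.+ b′ * a″) ℤ.+ b * (a′ * a″ ℤ.+ d * (b′ * b″))
    irr = solve-∀

  ⊗-comm : ∀ (x y : ℤ[√ d ]) → x ⊗ y ≡ y ⊗ x
  ⊗-comm (a +√ b) (a′ +√ b′) = cong₂ _+√_ (rat (+ d) a b a′ b′) (irr a b a′ b′)
    where
    rat : ∀ d a b a′ b′ → a * a′ ℤ.+ d * (b * b′) ≡ a′ * a ℤ.+ d * (b′ * b)
    rat = solve-∀
    irr : ∀ a b a′ b′ → a * b′ ℤ.+ b * a′ ≡ a′ * b ℤ.+ b′ * a
    irr = solve-∀

  ι-⊗ : ∀ c x y → ι c ⊗ (x +√ y) ≡ (c * x) +√ (c * y)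
  ι-⊗ c x y = cong₂ _+√_ (rat (+ d) c x y) (irr c x y)
    where
    rat : ∀ d c x y → c * x ℤ.+ d * (0ℤ * y) ≡ c * x
    rat = solve-∀
    irr : ∀ c x y → c * y ℤ.+ 0ℤ * x ≡ c * y
    irr = solve-∀

  ⊗-distribʳ-⊕ : ∀ (x y z : ℤ[√ d ]) → (y ⊕ z) ⊗ x ≡ y ⊗ x ⊕ z ⊗ x
  ⊗-distribʳ-⊕ (a +√ b) (a′ +√ b′) (a″ +√ b″) =
    cong₂ _+√_ (rat (+ d) a b a′ b′ a″ b″) (irr a b a′ b′ a″ b″)
    where
    rat : ∀ d a b a′ b′ a″ b″ →
          (a′ ℤ.+ a″) * a ℤ.+ d * ((b′ ℤ.+ b″) * b)
        ≡ (a′ * a ℤ.+ d * (b′ * b)) ℤ.+ (a″ * a ℤ.+ d * (b″ * b))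
    rat = solve-∀
    irr : ∀ a b a′ b′ a″ b″ →
          (a′ ℤ.+ a″) * b ℤ.+ (b′ ℤ.+ b″) * a
        ≡ (a′ * b ℤ.+ b′ * a) ℤ.+ (a″ * b ℤ.+ b″ * a)
    irr = solve-∀

  ⊝-⊗-distribˡ : ∀ (x y : ℤ[√ d ]) → (⊝ x) ⊗ y ≡ ⊝ (x ⊗ y)
  ⊝-⊗-distribˡ (a +√ b) (a′ +√ b′) = cong₂ _+√_ (rat (+ d) a b a′ b′) (irr a b a′ b′)
    where
    rat : ∀ d a b a′ b′ → (ℤ.- a) * a′ ℤ.+ d * ((ℤ.- b) * b′) ≡ ℤ.- (a * a′ ℤ.+ d * (b * b′))
    rat = solve-∀
    irr : ∀ a b a′ b′ → (ℤ.- a) * b′ ℤ.+ (ℤ.- b) * a′ ≡ ℤ.- (a * b′ ℤ.+ b * a′)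
    irr = solve-∀

  ℤ[√]-almostCommutativeRing : AlmostCommutativeRing 0ℓ 0ℓ
  ℤ[√]-almostCommutativeRing = record
    { Carrier = ℤ[√ d ]
    ; _≈_     = _≡_
    ; _+_     = _⊕_
    ; _*_     = _⊗_
    ; -_      = ⊝_
    ; 0#      = 0#
    ; 1#      = 1#
    ; isAlmostCommutativeRing = record
      { isCommutativeSemiring = isCommutativeSemiringˡ (record
        { +-isCommutativeMonoid = isCommutativeMonoidˡ (record
          { isSemigroup = record
            { isMagma = record { isEquivalence = isEquivalence ; ∙-cong = cong₂ _⊕_ }
            ; assoc   = λ { (a +√ b) _ _ → cong₂ _+√_ (ℤ.+-assoc a _ _) (ℤ.+-assoc b _ _) }
            }
          ; identityˡ = λ x → cong₂ _+√_ (ℤ.+-identityˡ _) (ℤ.+-identityˡ _)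
          ; comm      = λ { (a +√ b) _ → cong₂ _+√_ (ℤ.+-comm a _) (ℤ.+-comm b _) }
          })
        ; *-isCommutativeMonoid = isCommutativeMonoidˡ (record
          { isSemigroup = record
            { isMagma = record { isEquivalence = isEquivalence ; ∙-cong = cong₂ _⊗_ }
            ; assoc   = ⊗-assoc
            }
          ; identityˡ = λ { (a +√ b) → trans (ι-⊗ 1ℤ a b) (cong₂ _+√_ (ℤ.*-identityˡ a) (ℤ.*-identityˡ b)) }
          ; comm      = ⊗-comm
          })
        ; distribʳ = ⊗-distribʳ-⊕
        ; zeroˡ    = λ { (a +√ b) → ι-⊗ 0ℤ a b }
        })
      ; -‿cong       = cong ⊝_
      ; -‿*-distribˡ = ⊝-⊗-distribˡ
      ; -‿+-comm     = λ { (a +√ b) _ → sym (cong₂ _+√_ (ℤ.neg-distrib-+ a _) (ℤ.neg-distrib-+ b _)) }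
      }
    }

  ι-homomorphism : ℤ.+-*-rawRing -Raw-AlmostCommutative⟶ ℤ[√]-almostCommutativeRing
  ι-homomorphism = record
    { ⟦_⟧    = ι
    ; +-homo = λ _ _ → refl
    ; *-homo = λ x y → sym (trans (ι-⊗ x y 0ℤ) (cong (x * y +√_) (ℤ.*-zeroʳ x)))
    ; -‿homo = λ _ → refl
    ; 0-homo = refl
    ; 1-homo = refl
    }

  conj-⊕ : ∀ (x y : ℤ[√ d ]) → conj (x ⊕ y) ≡ conj x ⊕ conj y
  conj-⊕ (_ +√ b) (_ +√ b′) = cong (_ +√_) (ℤ.neg-distrib-+ b b′)

  conj-⊗ : ∀ (x y : ℤ[√ d ]) → conj (x ⊗ y) ≡ conj x ⊗ conj y
  conj-⊗ (a +√ b) (a′ +√ b′) = cong₂ _+√_ (rat (+ d) a b a′ b′) (irr a b a′ b′)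
    where
    rat : ∀ d a b a′ b′ → a * a′ ℤ.+ d * (b * b′) ≡ a * a′ ℤ.+ d * ((ℤ.- b) * (ℤ.- b′))
    rat = solve-∀
    irr : ∀ a b a′ b′ → ℤ.- (a * b′ ℤ.+ b * a′) ≡ a * (ℤ.- b′) ℤ.+ (ℤ.- b) * a′
    irr = solve-∀

  conj-involutive : ∀ (x : ℤ[√ d ]) → conj (conj x) ≡ x
  conj-involutive (a +√ b) = cong (a +√_) (ℤ.neg-involutive b)

  -- Rational integers act coordinatewise, so this reduces to ℤ; it does the work of an absence of
  -- zero divisors.
  ι-cancel : ∀ {c} {x : ℤ[√ d ]} → ι c ⊗ x ≡ 0# → c ≡ 0ℤ ⊎ x ≡ 0#
  ι-cancel {c} {x +√ y} cx≡0
    with ℤ.i*j≡0⇒i≡0∨j≡0 c (cong ℤ[√_].rational cx≡0′)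
       | ℤ.i*j≡0⇒i≡0∨j≡0 c (cong ℤ[√_].irrational cx≡0′)
    where
    cx≡0′ : (c * x) +√ (c * y) ≡ 0#
    cx≡0′ = trans (sym (ι-⊗ c x y)) cx≡0
  ... | inj₁ c≡0 | _        = inj₁ c≡0
  ... | inj₂ _   | inj₁ c≡0 = inj₁ c≡0
  ... | inj₂ x≡0 | inj₂ y≡0 = inj₂ (cong₂ _+√_ x≡0 y≡0)

  record Multiple (m : ℕ) (x : ℤ[√ d ]) : Set where
    constructor multiple
    field
      quotient : ℤ[√ d ]
      equality : x ≡ ι (+ m) ⊗ quotient

  record Congruent (m : ℕ) (x y : ℤ[√ d ]) : Set where
    constructor congruent
    field
      quotient : ℤ[√ d ]
      equality : x ≡ y ⊕ ι (+ m) ⊗ quotient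

  size : ℤ[√ d ] → ℕ
  size (x +√ y) = ∣ x ∣ ℕ.⊔ ∣ y ∣

-- Nonzero elements are not divisible by large powers of 2

m∣n∧n<m⇒n≡0 : ∀ {m n} → m ∣ n → n < m → n ≡ 0
m∣n∧n<m⇒n≡0 {n = zero}  _   _   = refl
m∣n∧n<m⇒n≡0 {n = suc _} m∣n n<m = contradiction (∣⇒≤ m∣n) (ℕ.<⇒≱ n<m)

n<2^n : ∀ n → n < 2 ^ n
n<2^n zero    = s≤s z≤n
n<2^n (suc n) = ℕ.+-mono-≤ (ℕ.m^n>0 2 n) (subst (n <_) (sym (ℕ.+-identityʳ (2 ^ n))) (n<2^n n))

i≡m*j∧∣i∣<m⇒i≡0 : ∀ {i} m j → i ≡ + m * j → ∣ i ∣ < m → i ≡ 0ℤ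
i≡m*j∧∣i∣<m⇒i≡0 m j refl ∣i∣<m = ℤ.∣i∣≡0⇒i≡0 (m∣n∧n<m⇒n≡0
  (divides ∣ j ∣ (trans (ℤ.abs-* (+ m) j) (ℕ.*-comm m ∣ j ∣))) ∣i∣<m)

module _ {d : ℕ} where

  small-multiple : ∀ {m} {x : ℤ[√ d ]} → Multiple m x → size x < m → x ≡ 0#
  small-multiple {m} {x +√ y} (multiple (x′ +√ y′) eq) size<m = cong₂ _+√_
    (i≡m*j∧∣i∣<m⇒i≡0 m x′ (cong ℤ[√_].rational eq′) (ℕ.≤-<-trans (ℕ.m≤m⊔n ∣ x ∣ ∣ y ∣) size<m))
    (i≡m*j∧∣i∣<m⇒i≡0 m y′ (cong ℤ[√_].irrational eq′) (ℕ.≤-<-trans (ℕ.m≤n⊔m ∣ x ∣ ∣ y ∣) size<m))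
    where
    eq′ : x +√ y ≡ (+ m * x′) +√ (+ m * y′)
    eq′ = trans eq (ι-⊗ (+ m) x′ y′)

  -- A nonzero multiple of m has a coordinate of absolute value at least m. The largest size j
  -- serves as a common exponent, because size x ≤ j < 2ʲ.
  nonzero⇒non-multiple : (xs : List ℤ[√ d ]) → All (_≢ 0#) xs →
                         ∃ λ j → All (λ x → ¬ Multiple (2 ^ j) x) xs
  nonzero⇒non-multiple xs xs≢0 = j , All.zipWith
    (λ (x≢0 , size≤j) 2ʲ∣x → x≢0 (small-multiple 2ʲ∣x (ℕ.≤-<-trans size≤j (n<2^n j))))
    (xs≢0 , map⁻ (xs≤max 0 (List.map size xs)))
    where
    j : ℕ
    j = max 0 (List.map size xs)

-- Strictly increasing sequences of natural numbers

module _ (f : ℕ → ℕ) (f-increasing : ∀ i → f i < f (suc i)) where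

  step-increasing⇒increasing : ∀ {i j} → i ℕ.<′ j → f i < f j
  step-increasing⇒increasing ℕ.<′-base       = f-increasing _
  step-increasing⇒increasing (ℕ.≤′-step i<j) =
    ℕ.<-trans (step-increasing⇒increasing i<j) (f-increasing _)

  step-increasing⇒injective : ∀ {i j} → f i ≡ f j → i ≡ j
  step-increasing⇒injective {i} {j} fi≡fj with ℕ.<-cmp i j
  ... | tri< i<j _ _ =
    contradiction fi≡fj (ℕ.<⇒≢ (step-increasing⇒increasing (ℕ.≤⇒≤′ i<j)))
  ... | tri≈ _ i≡j _ = i≡j
  ... | tri> _ _ j<i =
    contradiction (sym fi≡fj) (ℕ.<⇒≢ (step-increasing⇒increasing (ℕ.≤⇒≤′ j<i)))

-- Congruences and repeated squaring in ℤ[√d]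

module _ {d : ℕ} where

  private module ℤ[√] = AlmostCommutativeRing (ℤ[√]-almostCommutativeRing {d})
  open Identities (ℤ[√]-almostCommutativeRing {d}) ι-homomorphism public
    renaming (_-_ to _⊖_)

  incongruent⇒≢ : ∀ {m} {x x′ y y′ : ℤ[√ d ]} → Congruent m x x′ → Congruent m y y′ →
                  ¬ Multiple m (x′ ⊖ y′) → x ≢ y
  incongruent⇒≢ {m} {x′ = x′} {y′ = y′} (congruent k x≡) (congruent l y≡) ¬multiple x≡y =
    ¬multiple (multiple (l ⊖ k)
      (difference-multiple x′ y′ (ι (+ m)) k l (trans (sym x≡) (trans x≡y y≡))))

  residue-nonzero : ∀ {m} {x x′ : ℤ[√ d ]} → Congruent m x x′ → ¬ Multiple m (x′ ⊖ 0#) → x ≢ 0#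
  residue-nonzero {m} x≡x′ = incongruent⇒≢ {y′ = 0#} x≡x′
    (congruent 0# (sym (trans (ℤ[√].+-identityˡ _) (ℤ[√].zeroʳ (ι (+ m))))))

  multiple-double : ∀ {m} {z : ℤ[√ d ]} → Multiple m z → Multiple m (double z)
  multiple-double {m} (multiple y refl) = multiple _ (double-multiple (ι (+ m)) y)

  conj-double : ∀ (z : ℤ[√ d ]) → conj (double z) ≡ double (conj z)
  conj-double z = trans (conj-⊕ (ι (+ 2) ⊗ z) (ι (+ 4) ⊗ (z ⊗ z)))
    (cong₂ _⊕_ (conj-⊗ (ι (+ 2)) z) (trans (conj-⊗ (ι (+ 4)) (z ⊗ z)) (cong (ι (+ 4) ⊗_) (conj-⊗ z z))))

  conj-unit : ∀ (z : ℤ[√ d ]) → conj (unit z) ≡ unit (conj z)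
  conj-unit z = trans (conj-⊕ (ι (+ 1)) (ι (+ 4) ⊗ z)) (cong (ι (+ 1) ⊕_) (conj-⊗ (ι (+ 4)) z))

  irrational-double : ∀ (z : ℤ[√ d ]) →
    ℤ[√_].irrational (double z) ≡ + 2 * (ℤ[√_].irrational z * (+ 1 ℤ.+ + 4 * ℤ[√_].rational z))
  irrational-double (x +√ y) = lemma (+ d) x y
    where
    lemma : ∀ d x y → (+ 2 * y ℤ.+ 0ℤ * x) ℤ.+ (+ 4 * (x * y ℤ.+ y * x) ℤ.+ 0ℤ * (x * x ℤ.+ d * (y * y)))
                    ≡ + 2 * (y * (+ 1 ℤ.+ + 4 * x))
    lemma = solve-∀

  -- With w = 1 + 4z, the term of index j is (w^(2ʲ) - 1)/4.
  doublings : ℤ[√ d ] → ℕ → ℤ[√ d ]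
  doublings z zero    = z
  doublings z (suc j) = double (doublings z j)

  multiple-doublings : ∀ (z : ℤ[√ d ]) j → Multiple (2 ^ j) (doublings z j)
  multiple-doublings z zero    = multiple z (sym (ℤ[√].*-identityˡ z))
  multiple-doublings z (suc j) with doublings z j | multiple-doublings z j
  ... | _ | multiple y refl = multiple x (trans (double-multiple (ι (+ (2 ^ j))) y) (lemma x))
    where
    open _-Raw-AlmostCommutative⟶_ (ι-homomorphism {d}) using (*-homo)
    x : ℤ[√ d ]
    x = y ⊕ ι (+ 2) ⊗ (y ⊗ (ι (+ (2 ^ j)) ⊗ y))
    lemma : ∀ (x : ℤ[√ d ]) → ι (+ (2 ^ j)) ⊗ (ι (+ 2) ⊗ x) ≡ ι (+ (2 ^ suc j)) ⊗ x
    lemma x = begin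
      ι (+ (2 ^ j)) ⊗ (ι (+ 2) ⊗ x) ≡⟨ ℤ[√].*-assoc (ι (+ (2 ^ j))) (ι (+ 2)) x ⟨
      ι (+ (2 ^ j)) ⊗ ι (+ 2) ⊗ x   ≡⟨ cong (_⊗ x) (*-homo (+ (2 ^ j)) (+ 2)) ⟨
      ι (+ (2 ^ j) * + 2) ⊗ x       ≡⟨ cong (λ k → ι k ⊗ x) (ℤ.*-comm (+ (2 ^ j)) (+ 2)) ⟩
      ι (+ 2 * + (2 ^ j)) ⊗ x       ≡⟨ cong (λ k → ι k ⊗ x) (ℤ.pos-* 2 (2 ^ j)) ⟨
      ι (+ (2 ^ suc j)) ⊗ x         ∎
      where open ≡-Reasoning

-- Growth of the doubling sequence and rigidity of units of norm 1

i*j≡1⇒∣i∣≡1 : ∀ i {j} → i * j ≡ 1ℤ → ∣ i ∣ ≡ 1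
i*j≡1⇒∣i∣≡1 i {j} ij≡1 = ℕ.m*n≡1⇒m≡1 ∣ i ∣ ∣ j ∣ (trans (sym (ℤ.abs-* i j)) (cong ∣_∣ ij≡1))

1+4j≢0 : ∀ j → + 1 ℤ.+ + 4 * j ≢ 0ℤ
1+4j≢0 j 1+4j≡0 = contradiction (i*j≡1⇒∣i∣≡1 (+ 4) (trans (lemma j) (cong (λ i → 1ℤ ℤ.- i) 1+4j≡0))) λ ()
  where
  lemma : ∀ j → + 4 * (ℤ.- j) ≡ + 1 ℤ.- (+ 1 ℤ.+ + 4 * j)
  lemma = solve-∀

module _ {d : ℕ} where

  -- Each step multiplies the irrational coordinate by 2(1 + 4x), and 1 + 4x is a nonzero integer,
  -- so the absolute value at least doubles. Nonvanishing is carried along because strict growth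
  -- depends on it.
  doublings-increasing : ∀ (z : ℤ[√ d ]) → ℤ[√_].irrational z ≢ 0ℤ → ∀ j →
    ∣ ℤ[√_].irrational (doublings z j) ∣ ≢ 0 ×
    ∣ ℤ[√_].irrational (doublings z j) ∣ < ∣ ℤ[√_].irrational (doublings z (suc j)) ∣
  doublings-increasing z y₀≢0 = λ j → y≢0 j , y<y⁺ (doublings z j) (y≢0 j)
    where
    y<y⁺ : ∀ (z : ℤ[√ d ]) → ∣ ℤ[√_].irrational z ∣ ≢ 0 →
           ∣ ℤ[√_].irrational z ∣ < ∣ ℤ[√_].irrational (double z) ∣
    y<y⁺ z@(x +√ y) ∣y∣≢0 = begin-strict
      ∣ y ∣                                ≡⟨ ℕ.*-identityʳ ∣ y ∣ ⟨
      ∣ y ∣ ℕ.* 1                          ≤⟨ ℕ.*-monoʳ-≤ ∣ y ∣ (ℕ.n≢0⇒n>0 (1+4j≢0 x ∘ ℤ.∣i∣≡0⇒i≡0)) ⟩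
      ∣ y ∣ ℕ.* ∣ u ∣                      ≡⟨ ℤ.abs-* y u ⟨
      ∣ y * u ∣                            <⟨ ℕ.m<m+n ∣ y * u ∣ (ℕ.n≢0⇒n>0 ∣yu∣≢0) ⟩
      ∣ y * u ∣ ℕ.+ ∣ y * u ∣              ≡⟨ cong (∣ y * u ∣ ℕ.+_) (ℕ.+-identityʳ ∣ y * u ∣) ⟨
      2 ℕ.* ∣ y * u ∣                      ≡⟨ ℤ.abs-* (+ 2) (y * u) ⟨
      ∣ + 2 * (y * u) ∣                    ≡⟨ cong ∣_∣ (irrational-double z) ⟨
      ∣ ℤ[√_].irrational (double z) ∣      ∎
      where
      open ℕ.≤-Reasoning
      u : ℤ
      u = + 1 ℤ.+ + 4 * x
      ∣yu∣≢0 : ∣ y * u ∣ ≢ 0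
      ∣yu∣≢0 eq = [ ∣y∣≢0 ∘ cong ∣_∣ , 1+4j≢0 x ]′ (ℤ.i*j≡0⇒i≡0∨j≡0 y (ℤ.∣i∣≡0⇒i≡0 eq))

    y≢0 : ∀ j → ∣ ℤ[√_].irrational (doublings z j) ∣ ≢ 0
    y≢0 zero    = y₀≢0 ∘ ℤ.∣i∣≡0⇒i≡0
    y≢0 (suc j) = ℕ.m<n⇒n≢0 (y<y⁺ (doublings z j) (y≢0 j))

  -- Keeps one modulus valid for all later terms of the sequence.
  multiple-doublings-+ : ∀ {m} (z : ℤ[√ d ]) i j → Multiple m (doublings z j) →
                         Multiple m (doublings z (i ℕ.+ j))
  multiple-doublings-+ z zero    j m∣ = m∣
  multiple-doublings-+ z (suc i) j m∣ = multiple-double (multiple-doublings-+ z i j m∣)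

  defect-doublings : ∀ (z : ℤ[√ d ]) → defect z (conj z) ≡ 0# →
                     ∀ j → defect (doublings z j) (conj (doublings z j)) ≡ 0#
  defect-doublings z δ≡0 zero    = δ≡0
  defect-doublings z δ≡0 (suc j) = trans
    (cong (defect (doublings z (suc j))) (conj-double (doublings z j)))
    (defect-double (doublings z j) (conj (doublings z j)) (defect-doublings z δ≡0 j))

  unit-norm-conj : ∀ (z : ℤ[√ d ]) → defect z (conj z) ≡ 0# → unit z ⊗ unit (conj z) ≡ 1#
  unit-norm-conj z = unit-norm z (conj z)

  irrational-unit : ∀ (z : ℤ[√ d ]) → ℤ[√_].irrational (unit z) ≡ + 4 * ℤ[√_].irrational z
  irrational-unit (x +√ y) = lemma x y
    where
    lemma : ∀ x y → 0ℤ ℤ.+ (+ 4 * y ℤ.+ 0ℤ * x) ≡ + 4 * y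
    lemma = solve-∀

  same-unit⇒same-irrational : ∀ (z z′ : ℤ[√ d ]) → unit z ≡ unit z′ →
    ℤ[√_].irrational z ≡ ℤ[√_].irrational z′
  same-unit⇒same-irrational z z′ eq = ℤ.*-cancelˡ-≡ (+ 4) _ _
    (trans (sym (irrational-unit z)) (trans (cong ℤ[√_].irrational eq) (irrational-unit z′)))

  -- The trace w + w̄ is rational, so the annihilator in `fixed⇒annihilated` is a scalar to which
  -- `ι-cancel` applies.
  two-trace : ∀ (w : ℤ[√ d ]) → ι (+ 2 ℤ.- + 2 * ℤ[√_].rational w) ≡ ι (+ 2) ⊖ (w ⊕ conj w)
  two-trace (s +√ t) = cong₂ _+√_ (rat s) (irr t)
    where
    rat : ∀ s → + 2 ℤ.- + 2 * s ≡ + 2 ℤ.- (s ℤ.+ s)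
    rat = solve-∀
    irr : ∀ t → 0ℤ ≡ 0ℤ ℤ.+ (ℤ.- (t ℤ.+ (ℤ.- t)))
    irr = solve-∀

  -- With rational part 1, the norm equation 1 - dt² = 1 leaves dt² = 0.
  norm-one∧rational-one⇒trivial : + d ≢ 0ℤ → ∀ (w : ℤ[√ d ]) → w ⊗ conj w ≡ 1# →
    ℤ[√_].rational w ≡ 1ℤ → w ≡ 1#
  norm-one∧rational-one⇒trivial d≢0 (s +√ t) norm refl =
    cong (1ℤ +√_) ([ (λ d≡0 → contradiction d≡0 d≢0) , [ id , id ]′ ∘ ℤ.i*j≡0⇒i≡0∨j≡0 t ]′
      (ℤ.i*j≡0⇒i≡0∨j≡0 (+ d) dt²≡0))
    where
    lemma : ∀ d t → d * (t * t) ≡ 1ℤ ℤ.- (1ℤ * 1ℤ ℤ.+ d * (t * (ℤ.- t)))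
    lemma = solve-∀
    dt²≡0 : + d * (t * t) ≡ 0ℤ
    dt²≡0 = trans (lemma (+ d) t) (cong (λ u → 1ℤ ℤ.- u) (cong ℤ[√_].rational norm))

  -- (2 - w - w̄) x vanishes, while 2 - w - w̄ is a rational integer.
  fixed⇒trivial : + d ≢ 0ℤ → ∀ (x w : ℤ[√ d ]) → w ⊗ conj w ≡ 1# → x ≢ 0# →
    x ⊗ w ≡ x → w ≡ 1#
  fixed⇒trivial d≢0 x w norm x≢0 xw≡x = norm-one∧rational-one⇒trivial d≢0 w norm
    ([ rational≡1 (ℤ[√_].rational w) , (λ x≡0 → contradiction x≡0 x≢0) ]′ (ι-cancel annihilated))
    where
    annihilated : ι (+ 2 ℤ.- + 2 * ℤ[√_].rational w) ⊗ x ≡ 0#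
    annihilated = trans (cong (_⊗ x) (two-trace w)) (fixed⇒annihilated x w (conj w) xw≡x norm)
    rational≡1 : ∀ s → + 2 ℤ.- + 2 * s ≡ 0ℤ → s ≡ 1ℤ
    rational≡1 s 2-2s≡0 = ℤ.*-cancelˡ-≡ (+ 2) s 1ℤ (sym (ℤ.i-j≡0⇒i≡j (+ 2) (+ 2 * s) 2-2s≡0))

-- The infinite family of quadruples attached to a factorisation n = 4pq

module Family {d : ℕ} (d≢0 : + d ≢ 0ℤ)
  (p q : ℤ[√ d ]) (p≢0 : p ≢ 0#) (q≢cp : ∀ c → c ≢ 0ℤ → q ≢ ι c ⊗ p)
  (z₀ : ℤ[√ d ]) (z₀-irrational : ℤ[√_].irrational z₀ ≢ 0ℤ) (z₀-norm : defect z₀ (conj z₀) ≡ 0#)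
  where

  open Quadruple {d} p q

  ι-multiple-nonzero : ∀ {x} c {y : ℤ[√ d ]} → c ≢ 0ℤ → y ≢ 0# → x ≡ ι c ⊗ y → x ≢ 0#
  ι-multiple-nonzero c c≢0 y≢0 x≡cy x≡0 = [ c≢0 , y≢0 ]′ (ι-cancel (trans (sym x≡cy) x≡0))

  q-cp≢0 : ∀ c → c ≢ 0ℤ → q ⊖ ι c ⊗ p ≢ 0#
  q-cp≢0 c c≢0 eq = q≢cp c c≢0 (x-y≈0⇒x≈y q (ι c ⊗ p) eq)

  -- Their nonvanishing modulo 2ʲ separates all residues except those of a₃ and a₄, which are both
  -- `β`; `δ` is listed to handle that pair.
  residue-differences : List ℤ[√ d ]
  residue-differences =
    (α ⊖ 0#) ∷ (β ⊖ 0#) ∷ (γ ⊖ 0#) ∷ (δ ⊖ 0#) ∷ (α ⊖ β) ∷ (α ⊖ γ) ∷ (β ⊖ γ) ∷ []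

  residue-differences-nonzero : All (_≢ 0#) residue-differences
  residue-differences-nonzero =
      ι-multiple-nonzero (+ 1)     (λ ()) (q-cp≢0 (+ 9) (λ ()))     α-0
    ∷ ι-multiple-nonzero (+ 1)     (λ ()) (q-cp≢0 (+ 1) (λ ()))     β-0
    ∷ ι-multiple-nonzero -[1+ 3 ]  (λ ()) p≢0                       γ-0
    ∷ ι-multiple-nonzero (+ 4)     (λ ()) (q-cp≢0 (+ 3) (λ ()))     δ-0
    ∷ ι-multiple-nonzero -[1+ 7 ]  (λ ()) p≢0                       α-β
    ∷ ι-multiple-nonzero (+ 1)     (λ ()) (q-cp≢0 (+ 5) (λ ()))     α-γ
    ∷ ι-multiple-nonzero (+ 1)     (λ ()) (q-cp≢0 -[1+ 2 ] (λ ()))  β-γ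
    ∷ []

  α≢0 : α ≢ 0#
  α≢0 = q-cp≢0 (+ 9) (λ ())

  module Modulo (m : ℕ) where

    module _ {z : ℤ[√ d ]} where

      -- Conjugation fixes m, so z = my gives z̄ = m · conj y, and the polynomial residue formulas
      -- apply to both arguments.
      residue : (f g : ℤ[√ d ] → ℤ[√ d ] → ℤ[√ d ]) (x : ℤ[√ d ]) →
        (∀ y ȳ → f (ι (+ m) ⊗ y) (ι (+ m) ⊗ ȳ) ≡ x ⊕ ι (+ m) ⊗ g y ȳ) →
        Multiple m z → Congruent m (f z (conj z)) x
      residue f g x f≡ (multiple y refl) =
        congruent (g y (conj y))
          (trans (cong (f (ι (+ m) ⊗ y)) (conj-⊗ (ι (+ m)) y)) (f≡ y (conj y)))

      a₁≡α : Multiple m z → Congruent m (a₁ z (conj z)) α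
      a₁≡α = residue a₁ (λ y ȳ → ι (+ 4) ⊗ (α ⊗ ȳ)) α (a₁-residue (ι (+ m)))

      a₂≡γ : Multiple m z → Congruent m (a₂ z (conj z)) γ
      a₂≡γ = residue a₂ (λ y ȳ → α ⊗ ȳ ⊕ β ⊗ y) γ (a₂-residue (ι (+ m)))

      a₃≡β : Multiple m z → Congruent m (a₃ z (conj z)) β
      a₃≡β = residue a₃ (λ y ȳ → α ⊗ ȳ ⊕ β ⊗ y) β (a₃-residue (ι (+ m)))

      a₄≡β : Multiple m z → Congruent m (a₄ z (conj z)) β
      a₄≡β = residue a₄ (λ y ȳ → ι (+ 4) ⊗ (β ⊗ y)) β (a₄-residue (ι (+ m)))

      3a₄+α≡δ : Multiple m z → Congruent m (ι (+ 3) ⊗ a₄ z (conj z) ⊕ α) δ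
      3a₄+α≡δ = residue (λ z z̄ → ι (+ 3) ⊗ a₄ z z̄ ⊕ α) (λ y ȳ → ι (+ 12) ⊗ (β ⊗ y)) δ
        (3a₄+α-residue (ι (+ m)))

    module _ (α≢0 : ¬ Multiple m (α ⊖ 0#)) (β≢0 : ¬ Multiple m (β ⊖ 0#))
             (γ≢0 : ¬ Multiple m (γ ⊖ 0#)) (δ≢0 : ¬ Multiple m (δ ⊖ 0#))
             (α≢β : ¬ Multiple m (α ⊖ β)) (α≢γ : ¬ Multiple m (α ⊖ γ)) (β≢γ : ¬ Multiple m (β ⊖ γ))
      where

      -- Two parameters are allowed: z = z′ gives distinctness within a quadruple, z ≠ z′ helps to
      -- tell two quadruples apart.
      a₁≢a₂ : ∀ {z z′} → Multiple m z → Multiple m z′ → a₁ z (conj z) ≢ a₂ z′ (conj z′)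
      a₁≢a₂ m∣z m∣z′ = incongruent⇒≢ (a₁≡α m∣z) (a₂≡γ m∣z′) α≢γ

      a₁≢a₃ : ∀ {z z′} → Multiple m z → Multiple m z′ → a₁ z (conj z) ≢ a₃ z′ (conj z′)
      a₁≢a₃ m∣z m∣z′ = incongruent⇒≢ (a₁≡α m∣z) (a₃≡β m∣z′) α≢β

      a₁≢a₄ : ∀ {z z′} → Multiple m z → Multiple m z′ → a₁ z (conj z) ≢ a₄ z′ (conj z′)
      a₁≢a₄ m∣z m∣z′ = incongruent⇒≢ (a₁≡α m∣z) (a₄≡β m∣z′) α≢β

      module _ (z : ℤ[√ d ]) (m∣z : Multiple m z) (z-irrational : ∣ ℤ[√_].irrational z ∣ ≢ 0)
               (z-norm : defect z (conj z) ≡ 0#) where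

        -- Residues cannot separate these two. Equality would make w fix 3a₄ + α, which is nonzero
        -- by its residue `δ`; then w = 1, against the irrational part of z being nonzero.
        a₃≢a₄ : a₃ z (conj z) ≢ a₄ z (conj z)
        a₃≢a₄ a₃≡a₄ = z-irrational (cong ∣_∣ (same-unit⇒same-irrational z 0# (trans unit≡1 1≡unit)))
          where
          1≡unit : 1# ≡ unit 0#
          1≡unit = sym (cong (1# ⊕_) (ι-⊗ (+ 4) 0ℤ 0ℤ))
          unit≡1 : unit z ≡ 1#
          unit≡1 = fixed⇒trivial d≢0 (ι (+ 3) ⊗ a₄ z (conj z) ⊕ α) (unit z)
            (trans (cong (unit z ⊗_) (conj-unit z)) (unit-norm-conj z z-norm))
            (residue-nonzero (3a₄+α≡δ m∣z) δ≢0)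
            (a₄≈a₃⇒fixed z (conj z) z-norm (sym a₃≡a₄))

        quadruple : DQuadruple n
        quadruple = record
          { elements = a₁ z (conj z) ∷ a₂ z (conj z) ∷ a₃ z (conj z) ∷ a₄ z (conj z) ∷ []
          ; distinct =
              (a₁≢a₂ m∣z m∣z ∷ a₁≢a₃ m∣z m∣z ∷ a₁≢a₄ m∣z m∣z ∷ []) ∷
              ((incongruent⇒≢ (a₃≡β m∣z) (a₂≡γ m∣z) β≢γ ∘ sym) ∷
               (incongruent⇒≢ (a₄≡β m∣z) (a₂≡γ m∣z) β≢γ ∘ sym) ∷ []) ∷
              (a₃≢a₄ ∷ []) ∷ [] ∷ []
          ; nonZero  =
              residue-nonzero (a₁≡α m∣z) α≢0 ∷ residue-nonzero (a₂≡γ m∣z) γ≢0 ∷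
              residue-nonzero (a₃≡β m∣z) β≢0 ∷ residue-nonzero (a₄≡β m∣z) β≢0 ∷ []
          ; squares  =
              ((r′ , a₁a₂+n z (conj z) z-norm) ∷
               (a₁ z (conj z) ⊕ r′ , a₁a₃+n z (conj z) z-norm) ∷
               (β ⊖ ι (+ 2) ⊗ p , a₁a₄+n z (conj z) z-norm) ∷ []) ∷
              ((a₂ z (conj z) ⊕ r′ , a₂a₃+n z (conj z) z-norm) ∷
               (r′ ⊕ ι (+ 2) ⊗ a₂ z (conj z) , a₂a₄+n z (conj z) z-norm) ∷ []) ∷
              ((a₁ z (conj z) ⊕ ι (+ 2) ⊗ a₂ z (conj z) ⊕ ι (+ 3) ⊗ r′ ,
                a₃a₄+n z (conj z) z-norm) ∷ []) ∷ [] ∷ []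
          }
          where
          r′ : ℤ[√ d ]
          r′ = r z (conj z)

  -- From α w̄ = α v̄ the unit w v̄ fixes α ≠ 0, hence w v̄ = 1 and v = w.
  same-first⇒same-irrational : ∀ (z z′ : ℤ[√ d ]) →
    defect z (conj z) ≡ 0# → defect z′ (conj z′) ≡ 0# →
    a₁ z (conj z) ≡ a₁ z′ (conj z′) → ℤ[√_].irrational z ≡ ℤ[√_].irrational z′
  same-first⇒same-irrational z z′ z-norm z′-norm eq = sym (same-unit⇒same-irrational z′ z
    (trivial-quotient w w̄ v v̄ ww̄≡1 vv̄≡1 (fixed⇒trivial d≢0 α (w ⊗ v̄) quotient-norm-one α≢0
      (fixed-by-quotient w w̄ v v̄ ww̄≡1 α eq))))
    where
    w w̄ v v̄ : ℤ[√ d ]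
    w = unit z
    w̄ = unit (conj z)
    v = unit z′
    v̄ = unit (conj z′)
    ww̄≡1 : w ⊗ w̄ ≡ 1#
    ww̄≡1 = unit-norm-conj z z-norm
    vv̄≡1 : v ⊗ v̄ ≡ 1#
    vv̄≡1 = unit-norm-conj z′ z′-norm
    conj-quotient : conj (w ⊗ v̄) ≡ w̄ ⊗ v
    conj-quotient = trans (conj-⊗ w v̄) (cong₂ _⊗_ (conj-unit z)
      (trans (conj-unit (conj z′)) (cong unit (conj-involutive z′))))
    quotient-norm-one : (w ⊗ v̄) ⊗ conj (w ⊗ v̄) ≡ 1#
    quotient-norm-one = trans (cong ((w ⊗ v̄) ⊗_) conj-quotient) (quotient-norm w w̄ v v̄ ww̄≡1 vv̄≡1)

  infinite-modulo : ∀ j₀ → All (λ x → ¬ Multiple (2 ^ j₀) x) residue-differences →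
                    Infinite (DQuadrupleSetoid n)
  infinite-modulo j₀ (α∤ ∷ β∤ ∷ γ∤ ∷ δ∤ ∷ αβ∤ ∷ αγ∤ ∷ βγ∤ ∷ []) = record
    { to        = quadruples
    ; cong      = λ { refl → id , id }
    -- The first element of quadruple i lies in quadruple j. Residues rule out the last three
    -- positions, so the first elements agree, and the strictly growing irrational parts force equal
    -- indices.
    ; injective = λ {i} {j} eq → ℕ.+-cancelʳ-≡ j₀ i j (step-increasing⇒injective
        (λ j → ∣ ℤ[√_].irrational (doublings z₀ j) ∣)
        (λ j → proj₂ (doublings-increasing z₀ z₀-irrational j))
        (cong ∣_∣ (first-member i j (proj₁ eq (here refl)))))
    }
    where
    open Modulo (2 ^ j₀)
    z : ℕ → ℤ[√ d ]
    -- The shift by `j₀` makes every term divisible by 2^j₀.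
    z i = doublings z₀ (i ℕ.+ j₀)
    m∣z : ∀ i → Multiple (2 ^ j₀) (z i)
    m∣z i = multiple-doublings-+ z₀ i j₀ (multiple-doublings z₀ j₀)
    z-norm : ∀ i → defect (z i) (conj (z i)) ≡ 0#
    z-norm i = defect-doublings z₀ z₀-norm (i ℕ.+ j₀)
    quadruples : ℕ → DQuadruple n
    quadruples i = quadruple α∤ β∤ γ∤ δ∤ αβ∤ αγ∤ βγ∤ (z i) (m∣z i)
      (proj₁ (doublings-increasing z₀ z₀-irrational (i ℕ.+ j₀))) (z-norm i)
    first-member : ∀ i j → a₁ (z i) (conj (z i)) ∈ DQuadruple.elements (quadruples j) →
                   ℤ[√_].irrational (z i) ≡ ℤ[√_].irrational (z j)
    first-member i j (here eq) =
      same-first⇒same-irrational (z i) (z j) (z-norm i) (z-norm j) eq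
    first-member i j (there (here eq)) =
      contradiction eq (a₁≢a₂ α∤ β∤ γ∤ δ∤ αβ∤ αγ∤ βγ∤ (m∣z i) (m∣z j))
    first-member i j (there (there (here eq))) =
      contradiction eq (a₁≢a₃ α∤ β∤ γ∤ δ∤ αβ∤ αγ∤ βγ∤ (m∣z i) (m∣z j))
    first-member i j (there (there (there (here eq)))) =
      contradiction eq (a₁≢a₄ α∤ β∤ γ∤ δ∤ αβ∤ αγ∤ βγ∤ (m∣z i) (m∣z j))

  infinite : Infinite (DQuadrupleSetoid n)
  infinite = infinite-modulo (proj₁ modulus) (proj₂ modulus)
    where
    modulus : ∃ λ j → All (λ x → ¬ Multiple (2 ^ j) x) residue-differences
    modulus = nonzero⇒non-multiple residue-differences residue-differences-nonzero

-- The unit from the negative Pell equation and the choice of factorisation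

i*i+1≢0 : ∀ i → i * i ℤ.+ 1ℤ ≢ 0ℤ
i*i+1≢0 (+ n)    eq with () ← trans (ℕ.+-comm 1 (n ℕ.* n))
  (cong ∣_∣ (trans (cong (ℤ._+ 1ℤ) (ℤ.pos-* n n)) eq))
i*i+1≢0 -[1+ n ] ()

module NegativePell {d : ℕ} (d≢1 : d ≢ 1) (x y : ℤ) (pell : + d * (y * y) ≡ x * x ℤ.+ 1ℤ) where

  private
    D : ℤ
    D = + d * (y * y)

  d≢0 : + d ≢ 0ℤ
  d≢0 d≡0 = i*i+1≢0 x (trans (sym pell) (cong (_* (y * y)) d≡0))

  -- If x = 0, the equation reads dy² = 1 and forces d = 1.
  x≢0 : x ≢ 0ℤ
  x≢0 x≡0 = d≢1 (i*j≡1⇒∣i∣≡1 (+ d) (trans pell (cong (λ x → x * x ℤ.+ 1ℤ) x≡0)))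

  y≢0 : y ≢ 0ℤ
  y≢0 y≡0 = i*i+1≢0 x (trans (sym pell) (trans (cong (λ y → + d * (y * y)) y≡0) (ℤ.*-zeroʳ (+ d))))

  -- (x + y√d)⁴ = 1 + 4z
  z : ℤ[√ d ]
  z = (+ 2 * (D * (x * x))) +√ (x * y * (+ 2 * D ℤ.- 1ℤ))

  z-irrational : ℤ[√_].irrational z ≢ 0ℤ
  z-irrational eq = [ [ x≢0 , y≢0 ]′ ∘ ℤ.i*j≡0⇒i≡0∨j≡0 x , odd ]′ (ℤ.i*j≡0⇒i≡0∨j≡0 (x * y) eq)
    where
    odd : + 2 * D ℤ.- 1ℤ ≢ 0ℤ
    odd 2D-1≡0 = contradiction (i*j≡1⇒∣i∣≡1 (+ 2) (ℤ.i-j≡0⇒i≡j (+ 2 * D) 1ℤ 2D-1≡0)) λ ()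

  -- The rational coordinate of the defect contains the factor x² + 1 - D, which vanishes by `pell`;
  -- the irrational coordinate cancels identically.
  z-norm : defect z (conj z) ≡ 0#
  z-norm = cong₂ _+√_ (trans (rat (+ d) x y) vanish)
    (irr (+ d) (ℤ[√_].rational z) (ℤ[√_].irrational z))
    where
    rat : ∀ d x y → let D = d * (y * y) ; u = + 2 * (D * (x * x)) ; v = x * y * (+ 2 * D ℤ.- 1ℤ) in
      u ℤ.+ u ℤ.+ (+ 4 * (u * u ℤ.+ d * (v * (ℤ.- v))) ℤ.+ d * (0ℤ * (u * (ℤ.- v) ℤ.+ v * u)))
      ≡ + 16 * (D * D * (x * x)) * (x * x ℤ.+ 1ℤ ℤ.- D)
    rat = solve-∀
    irr : ∀ d u v → v ℤ.+ (ℤ.- v) ℤ.+ (+ 4 * (u * (ℤ.- v) ℤ.+ v * u)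
      ℤ.+ 0ℤ * (u * u ℤ.+ d * (v * (ℤ.- v)))) ≡ 0ℤ
    irr = solve-∀
    vanish : + 16 * (D * D * (x * x)) * (x * x ℤ.+ 1ℤ ℤ.- D) ≡ 0ℤ
    vanish = trans (cong (+ 16 * (D * D * (x * x)) *_) (ℤ.i≡j⇒i-j≡0 (sym pell)))
      (ℤ.*-zeroʳ (+ 16 * (D * D * (x * x))))

  -- With p = 1 all integer multiples of p are rational, whereas q = m + k√d is not.
  infinite-irrational : ∀ m k → k ≢ 0ℤ → Infinite (DQuadrupleSetoid {d} (+ 4 * m +√ + 4 * k))
  infinite-irrational m k k≢0 = subst (λ n → Infinite (DQuadrupleSetoid n)) n≡
    (Family.infinite d≢0 1# (m +√ k) (λ ()) q≢c z z-irrational z-norm)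
    where
    q≢c : ∀ c → c ≢ 0ℤ → m +√ k ≢ ι c ⊗ 1#
    q≢c c _ eq = k≢0 (trans (cong ℤ[√_].irrational (trans eq (ι-⊗ c 1ℤ 0ℤ))) (ℤ.*-zeroʳ c))
    n≡ : ι (+ 4) ⊗ (1# ⊗ (m +√ k)) ≡ + 4 * m +√ + 4 * k
    n≡ = trans (cong (ι (+ 4) ⊗_) (trans (ι-⊗ 1ℤ m k)
      (cong₂ _+√_ (ℤ.*-identityˡ m) (ℤ.*-identityˡ k)))) (ι-⊗ (+ 4) m k)

  -- m = (x + y√d) · m(-x + y√d)
  infinite-rational : ∀ m → Infinite (DQuadrupleSetoid {d} (+ 4 * m +√ 0ℤ))
  infinite-rational m = subst (λ n → Infinite (DQuadrupleSetoid n)) n≡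
    (Family.infinite d≢0 (x +√ y) ((m * (ℤ.- x)) +√ (m * y)) (x≢0 ∘ cong ℤ[√_].rational)
      q≢cp z z-irrational z-norm)
    where
    -- Comparing coordinates gives cx = -mx and cy = my, so 2cxy = -mxy + mxy = 0. The case c = 0
    -- has to be left out: m = 0 gives q = 0.
    q≢cp : ∀ c → c ≢ 0ℤ → (m * (ℤ.- x)) +√ (m * y) ≢ ι c ⊗ (x +√ y)
    q≢cp c c≢0 eq = [ [ (λ ()) , c≢0 ]′ ∘ ℤ.i*j≡0⇒i≡0∨j≡0 (+ 2) , [ x≢0 , y≢0 ]′ ∘ ℤ.i*j≡0⇒i≡0∨j≡0 x ]′
      (ℤ.i*j≡0⇒i≡0∨j≡0 (+ 2 * c) (trans (combine c x y) (trans (cong₂ (λ u v → u * y ℤ.+ v * x)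
        (sym (cong ℤ[√_].rational eq′)) (sym (cong ℤ[√_].irrational eq′))) (cancel m x y))))
      where
      eq′ : (m * (ℤ.- x)) +√ (m * y) ≡ (c * x) +√ (c * y)
      eq′ = trans eq (ι-⊗ c x y)
      combine : ∀ c x y → + 2 * c * (x * y) ≡ c * x * y ℤ.+ c * y * x
      combine = solve-∀
      cancel : ∀ m x y → m * (ℤ.- x) * y ℤ.+ m * y * x ≡ 0ℤ
      cancel = solve-∀
    n≡ : ι (+ 4) ⊗ ((x +√ y) ⊗ ((m * (ℤ.- x)) +√ (m * y))) ≡ + 4 * m +√ 0ℤ
    n≡ = trans (cong (ι (+ 4) ⊗_) (cong₂ _+√_ (trans (rat (+ d) m x y) one) (irr m x y))) (ι-⊗ (+ 4) m 0ℤ)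
      where
      rat : ∀ d m x y → x * (m * (ℤ.- x)) ℤ.+ d * (y * (m * y)) ≡ m * (d * (y * y) ℤ.- x * x)
      rat = solve-∀
      irr : ∀ m x y → x * (m * y) ℤ.+ y * (m * (ℤ.- x)) ≡ 0ℤ
      irr = solve-∀
      difference : ∀ x → x * x ℤ.+ 1ℤ ℤ.- x * x ≡ 1ℤ
      difference = solve-∀
      one : m * (D ℤ.- x * x) ≡ m
      one = trans (cong (m *_) (trans (cong (ℤ._- x * x) pell) (difference x))) (ℤ.*-identityʳ m)

theorem1p2 : (d : ℕ) → d > 0 → d % 4 ≡ 2 → SquareFree d →
    PellSolvable d -1ℤ → PellSolvable d (+ 6) →
    (m k : ℤ) → ¬ (m %ℕ 6 ≡ 5 × k %ℕ 6 ≡ 3) →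
    Infinite (DQuadrupleSetoid {d} (+ 4 * m +√ + 4 * k))
theorem1p2 d _ d%4≡2 _ (x , y , x²-dy²≡-1) _ m k _ = by-cases (k ℤ.≟ 0ℤ)
  where
  d≢1 : d ≢ 1
  d≢1 refl = contradiction d%4≡2 λ ()
  -- The products ending in `1ℤ` are the unfolded squares `x ^ 2` and `y ^ 2` of `PellSolvable`.
  rearrange : ∀ d x y → d * (y * y) ≡ x * x ℤ.- (x * (x * 1ℤ) ℤ.- d * (y * (y * 1ℤ)))
  rearrange = solve-∀
  open NegativePell d≢1 x y (trans (rearrange (+ d) x y) (cong (λ c → x * x ℤ.- c) x²-dy²≡-1))
  by-cases : Dec (k ≡ 0ℤ) → Infinite (DQuadrupleSetoid {d} (+ 4 * m +√ + 4 * k))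
  by-cases (no k≢0)   = infinite-irrational m k k≢0
  by-cases (yes refl) = infinite-rational m
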